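{- Let a natural deduction theory with classifier $p:\mathbb P\to\mathbf{ctx}$ be given, with entailment classifier $e:\mathbb E\to\mathbf{ctx}$. Interaction of arrows and products in $\mathbb P$ lifts to $\mathbb E$ in the sense that the rule $$\frac{x;\psi\vdash\phi\qquad x;\bot\vdash\chi}{x;\psi\wedge\chi\vdash\phi\wedge\chi}\ (F)$$ is in the theory. That is, there is a functor $f:\mathbb E\times_{\mathbf{ctx}}\mathbb P\to\mathbb E$ belonging to the rules $\mathscr R$ of the theory that sends a pair $(\psi\to\phi,\chi)$ over $x$ to a vertical arrow $\psi\wedge\chi\to\phi\wedge\chi$ over $x$.
   Context: Judgemental theory: a category $\mathbf{ctx}$ with terminal object, a set $\mathscr R$ of functors ("rules"), of which those with codomain $\mathbf{ctx}$ are the "judgements" $\mathscr J$, and a set $\mathscr P$ of natural transformations ("policies") filling triangles of rules, such that: $\mathscr R,\mathscr P$ are closed under composition and under finite limits (pullbacks, equalizers, finite powers $\mathcal X^n$ and arrow categories $\mathcal X^{\mathsf 2}$ with $\mathrm{dom},\mathrm{cod}$ and the tautological transformation $\mathrm{dom}\Rightarrow\mathrm{cod}$; projections and functors induced by the universal properties from cones made of rules (and policies) are again in $\mathscr R$), $\mathscr P$ is closed under whiskering with rules, and the theory is closed under $\sharp$-liftings: given rules $\lambda:\mathcal F\to\mathcal G$, $r:\mathcal F\to\mathcal X$, $r':\mathcal G\to\mathcal X$, a policy $\lambda^\sharp:r'\lambda\Rightarrow r$ and a rule $h:\mathcal H\to\mathcal X$ which is a fibration, the functor $\mathcal F\times_{\mathcal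 X}\mathcal H\to\mathcal G\times_{\mathcal X}\mathcal H$, $(F,H)\mapsto(\lambda F,H[\lambda^\sharp_F])$ is in $\mathscr R$, and the natural transformation with components the cartesian lifts $H[\lambda^\sharp_F]\to H$ is in $\mathscr P$ (and dually for opfibrations). Natural deduction theory (NDT): the judgemental theory generated by one classifier $p:\mathbb P\to\mathbf{ctx}$, where $\mathbf{ctx}$ is the category of finite sets and $p$ is a faithful fibration with fibered finite products $\wedge$, fibered implication and fibered initial objects (these operators, e.g. $\wedge:\mathbb P\times_{\mathbf{ctx}}\mathbb P\to\mathbb P$, being counted among the rules). It is required to be substitutional: judgement classifiers are fibrations, rules preserve cartesian maps, policies have cartesian components. Entailment classifier: let $I:\mathbf{ctx}\to\mathbf{ctx}^{\mathsf 2}$, $x\mapsto\mathrm{id}_x$; $\mathbb E$ is the pullback of $p^{\mathsf 2}:\mathbb P^{\mathsf 2}\to\mathbf{ctx}^{\mathsf 2}$ along $I$, i.e. the category of $p$-vertical arrows, with projection $e:\mathbb E\to\mathbf{ctx}$. The judgement $x;\psi\vdash\phi$ means that there is an object $\psi\to\phi$ of $\mathbb E$ over $x$; the premise $x;\bot\vdash\chi$ just records a formula $\chi\in\mathbb P$ over $x$. -}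

module Defs where

open import Level using (Level; Lift; lift) renaming (suc to lsuc)
open import Axiom.UniquenessOfIdentityProofs.WithK using (uip)
open import Data.Fin.Base using (Fin; zero; suc)
open import Data.Nat.Base using (ℕ; zero; suc)
open import Data.Product using (Σ; Σ-syntax; ∃!; _×_; _,_)
open import Data.Unit.Base using (⊤; tt)
open import Data.Vec.Base using (Vec; lookup; map; tabulate)
open import Data.Vec.Properties
  using (map-cong; map-id; map-∘; lookup-map; lookup∘tabulate; tabulate∘lookup; tabulate-∘; tabulate-cong)
open import Function.Bundles using (_↔_; module Inverse)
open import Relation.Binary.HeterogeneousEquality using (_≅_; refl; ≅-to-≡; ≡-to-≅)
  renaming (sym to ≅-sym; trans to ≅-trans)
open import Relation.Binary.PropositionalEquality
  using (_≡_; refl; sym; trans; cong; cong₂)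

private
  variable
    ℓ : Level

-- Objects and arrows are sets, compared by propositional equality: pullbacks
-- of categories are strict, so objects have to be compared as well as arrows.
record Category ℓ : Set (lsuc (lsuc ℓ)) where
  infixr 9 _∘_
  field
    Obj       : Set (lsuc ℓ)
    Hom       : Obj → Obj → Set ℓ
    id        : ∀ {a} → Hom a a
    _∘_       : ∀ {a b c} → Hom b c → Hom a b → Hom a c
    identityˡ : ∀ {a b} (f : Hom a b) → id ∘ f ≡ f
    identityʳ : ∀ {a b} (f : Hom a b) → f ∘ id ≡ f
    assoc     : ∀ {a b c d} (h : Hom c d) (g : Hom b c) (f : Hom a b) →
                (h ∘ g) ∘ f ≡ h ∘ (g ∘ f)

  ∘-resp-≅ : ∀ {a a′ b b′ c c′} → a ≡ a′ → b ≡ b′ → c ≡ c′ →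
             {g : Hom b c} {g′ : Hom b′ c′} {f : Hom a b} {f′ : Hom a′ b′} →
             g ≅ g′ → f ≅ f′ → g ∘ f ≅ g′ ∘ f′
  ∘-resp-≅ refl refl refl refl refl = refl

  id-≅ : ∀ {a b} → a ≡ b → id {a} ≅ id {b}
  id-≅ refl = refl

open Category using (Obj)

infix 10 _[_,_] _[_∘_]

_[_,_] : (C : Category ℓ) → Obj C → Obj C → Set ℓ
C [ a , b ] = Category.Hom C a b

_[_∘_] : (C : Category ℓ) → ∀ {a b c} → C [ b , c ] → C [ a , b ] → C [ a , c ]
C [ g ∘ f ] = Category._∘_ C g f

record Functor (C D : Category ℓ) : Set (lsuc ℓ) where
  private
    module C = Category C
    module D = Category D
  field
    F₀           : Obj C → Obj D
    F₁           : ∀ {a b} → C [ a , b ] → D [ F₀ a , F₀ b ]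
    identity     : ∀ {a} → F₁ (C.id {a}) ≡ D.id
    homomorphism : ∀ {a b c} (g : C [ b , c ]) (f : C [ a , b ]) →
                   F₁ (g C.∘ f) ≡ F₁ g D.∘ F₁ f

open Functor using (F₀; F₁)

private
  variable
    A B C D X Y : Category ℓ

idF : Functor C C
idF = record
  { F₀ = λ a → a ; F₁ = λ f → f ; identity = refl ; homomorphism = λ _ _ → refl }

infixr 9 _∘F_

_∘F_ : Functor B C → Functor A B → Functor A C
G ∘F F = record
  { F₀ = λ a → F₀ G (F₀ F a)
  ; F₁ = λ f → F₁ G (F₁ F f)
  ; identity = trans (cong (F₁ G) (Functor.identity F)) (Functor.identity G)
  ; homomorphism = λ g f →
      trans (cong (F₁ G) (Functor.homomorphism F g f)) (Functor.homomorphism G _ _)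
  }

infix 4 _≡F_

-- Equality of functors, ignoring the proofs of the functor laws.
record _≡F_ {C D : Category ℓ} (F G : Functor C D) : Set (lsuc ℓ) where
  field
    eq₀ : ∀ a → F₀ F a ≡ F₀ G a
    eq₁ : ∀ {a b} (f : C [ a , b ]) → F₁ F f ≅ F₁ G f

open _≡F_ using (eq₀; eq₁)

infix 4 _⇒_

record _⇒_ {C D : Category ℓ} (F G : Functor C D) : Set (lsuc ℓ) where
  field
    η       : ∀ a → D [ F₀ F a , F₀ G a ]
    natural : ∀ {a b} (f : C [ a , b ]) →
              D [ η b ∘ F₁ F f ] ≡ D [ F₁ G f ∘ η a ]

open _⇒_ using (η)

idN : {F : Functor C D} → F ⇒ F
idN {D = D} = record
  { η = λ _ → id ; natural = λ f → trans (identityˡ _) (sym (identityʳ _)) }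
  where open Category D

infixr 9 _∘ᵥ_ _∘ˡ_ _∘ʳ_

_∘ᵥ_ : {F G H : Functor C D} → G ⇒ H → F ⇒ G → F ⇒ H
_∘ᵥ_ {D = D} β α = record
  { η = λ a → η β a ∘ η α a
  ; natural = λ f →
      trans (assoc _ _ _)
      (trans (cong (η β _ ∘_) (_⇒_.natural α f))
      (trans (sym (assoc _ _ _))
      (trans (cong (_∘ η α _) (_⇒_.natural β f))
      (assoc _ _ _))))
  }
  where open Category D

_∘ˡ_ : (H : Functor C D) {F G : Functor B C} → F ⇒ G → H ∘F F ⇒ H ∘F G
H ∘ˡ α = record
  { η = λ a → F₁ H (η α a)
  ; natural = λ f →
      trans (sym (Functor.homomorphism H _ _))
      (trans (cong (F₁ H) (_⇒_.natural α f)) (Functor.homomorphism H _ _))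
  }

_∘ʳ_ : {F G : Functor B C} → F ⇒ G → (K : Functor A B) → F ∘F K ⇒ G ∘F K
α ∘ʳ K = record
  { η = λ a → η α (F₀ K a) ; natural = λ f → _⇒_.natural α (F₁ K f) }

-- Equality of transformations whose boundaries are equal in the sense of _≡F_.
record _≡N_ {C D : Category ℓ} {F F′ G G′ : Functor C D}
            (α : F ⇒ G) (α′ : F′ ⇒ G′) : Set (lsuc ℓ) where
  field
    source : F ≡F F′
    target : G ≡F G′
    eqη    : ∀ a → η α a ≅ η α′ a

Terminal : Category ℓ → Set (lsuc ℓ)
Terminal C = Σ[ t ∈ Obj C ] (∀ a → ∃! _≡_ λ (f : C [ a , t ]) → ⊤)

private
  ≅-irrelevant : ∀ {a} {A A′ : Set a} {x : A} {y : A′} (e e′ : x ≅ y) → e ≡ e′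
  ≅-irrelevant refl refl = refl

module _ {A B C : Category ℓ} (F : Functor A C) (G : Functor B C) where

  private
    module A = Category A
    module B = Category B
    module C = Category C

  record PullbackObj : Set (lsuc ℓ) where
    constructor ⟪_,_,_⟫
    field
      fst  : Obj A
      snd  : Obj B
      over : F₀ F fst ≡ F₀ G snd

  open PullbackObj

  record PullbackHom (a b : PullbackObj) : Set ℓ where
    constructor ⟪_,_,_⟫
    field
      fst  : A [ fst a , fst b ]
      snd  : B [ snd a , snd b ]
      over : F₁ F fst ≅ F₁ G snd

  pullback-hom-≡ : ∀ {a b} {m n : PullbackHom a b} →
                   PullbackHom.fst m ≡ PullbackHom.fst n →
                   PullbackHom.snd m ≡ PullbackHom.snd n → m ≡ n
  pullback-hom-≡ {m = ⟪ f , g , e ⟫} {⟪ .f , .g , e′ ⟫} refl refl =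
    cong ⟪ f , g ,_⟫ (≅-irrelevant e e′)

  Pullback : Category ℓ
  Pullback = record
    { Obj = PullbackObj
    ; Hom = PullbackHom
    ; id = λ {a} → ⟪ A.id , B.id
           , ≅-trans (≡-to-≅ (Functor.identity F))
             (≅-trans (C.id-≅ (over a)) (≡-to-≅ (sym (Functor.identity G)))) ⟫
    ; _∘_ = λ { {a} {b} {c} ⟪ g , g′ , e ⟫ ⟪ f , f′ , d ⟫ →
        ⟪ g A.∘ f , g′ B.∘ f′
        , ≅-trans (≡-to-≅ (Functor.homomorphism F g f))
          (≅-trans (C.∘-resp-≅ (over a) (over b) (over c) e d)
          (≡-to-≅ (sym (Functor.homomorphism G g′ f′)))) ⟫ }
    ; identityˡ = λ _ → pullback-hom-≡ (A.identityˡ _) (B.identityˡ _)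
    ; identityʳ = λ _ → pullback-hom-≡ (A.identityʳ _) (B.identityʳ _)
    ; assoc = λ _ _ _ → pullback-hom-≡ (A.assoc _ _ _) (B.assoc _ _ _)
    }

  π₁ : Functor Pullback A
  π₁ = record
    { F₀ = PullbackObj.fst ; F₁ = PullbackHom.fst
    ; identity = refl ; homomorphism = λ _ _ → refl }

  π₂ : Functor Pullback B
  π₂ = record
    { F₀ = PullbackObj.snd ; F₁ = PullbackHom.snd
    ; identity = refl ; homomorphism = λ _ _ → refl }

module _ {A B : Category ℓ} (F G : Functor A B) where

  private
    module A = Category A
    module B = Category B

    ΣHom : (a b : Σ[ a ∈ Obj A ] F₀ F a ≡ F₀ G a) → Set ℓ
    ΣHom (a , _) (b , _) = Σ[ f ∈ A [ a , b ] ] F₁ F f ≅ F₁ G f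

    hom-≡ : ∀ {a b} {m n : ΣHom a b} → Σ.proj₁ m ≡ Σ.proj₁ n → m ≡ n
    hom-≡ {m = f , e} {.f , e′} refl = cong (f ,_) (≅-irrelevant e e′)

  Equalizer : Category ℓ
  Equalizer = record
    { Obj = Σ[ a ∈ Obj A ] F₀ F a ≡ F₀ G a
    ; Hom = ΣHom
    ; id = λ { {_ , e} → A.id
           , ≅-trans (≡-to-≅ (Functor.identity F))
             (≅-trans (B.id-≅ e) (≡-to-≅ (sym (Functor.identity G)))) }
    ; _∘_ = λ { {_ , x} {_ , y} {_ , z} (g , e) (f , d) → g A.∘ f
        , ≅-trans (≡-to-≅ (Functor.homomorphism F g f))
          (≅-trans (B.∘-resp-≅ x y z e d)
          (≡-to-≅ (sym (Functor.homomorphism G g f)))) }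
    ; identityˡ = λ { {a} {b} (f , _) → hom-≡ {a} {b} (A.identityˡ f) }
    ; identityʳ = λ { {a} {b} (f , _) → hom-≡ {a} {b} (A.identityʳ f) }
    ; assoc = λ { {a} {b} {c} {d} (h , _) (g , _) (f , _) → hom-≡ {a} {d} (A.assoc h g f) }
    }

  equalize : Functor Equalizer A
  equalize = record
    { F₀ = Σ.proj₁ ; F₁ = Σ.proj₁ ; identity = refl ; homomorphism = λ _ _ → refl }

Power : Category ℓ → ℕ → Category ℓ
Power {ℓ} X zero = record
  { Obj = Lift (lsuc ℓ) ⊤ ; Hom = λ _ _ → Lift ℓ ⊤ ; id = lift tt ; _∘_ = λ _ _ → lift tt
  ; identityˡ = λ _ → refl ; identityʳ = λ _ → refl ; assoc = λ _ _ _ → refl }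
Power X (suc n) = record
  { Obj = Obj X × Obj (Power X n)
  ; Hom = λ { (a , as) (b , bs) → X [ a , b ] × Power X n [ as , bs ] }
  ; id = X.id , Xⁿ.id
  ; _∘_ = λ { (g , gs) (f , fs) → g X.∘ f , gs Xⁿ.∘ fs }
  ; identityˡ = λ { (f , fs) → cong₂ _,_ (X.identityˡ f) (Xⁿ.identityˡ fs) }
  ; identityʳ = λ { (f , fs) → cong₂ _,_ (X.identityʳ f) (Xⁿ.identityʳ fs) }
  ; assoc = λ { (h , hs) (g , gs) (f , fs) →
      cong₂ _,_ (X.assoc h g f) (Xⁿ.assoc hs gs fs) }
  }
  where
  module X = Category X
  module Xⁿ = Category (Power X n)

proj : (X : Category ℓ) (n : ℕ) → Fin n → Functor (Power X n) X
proj X (suc n) zero = record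
  { F₀ = Σ.proj₁ ; F₁ = Σ.proj₁ ; identity = refl ; homomorphism = λ _ _ → refl }
proj X (suc n) (suc i) = proj X n i ∘F record
  { F₀ = Σ.proj₂ ; F₁ = Σ.proj₂ ; identity = refl ; homomorphism = λ _ _ → refl }

module _ (X : Category ℓ) where

  private module X = Category X

  record ArrowObj : Set (lsuc ℓ) where
    constructor arrow
    field
      {src tgt} : Obj X
      arr       : X [ src , tgt ]

  open ArrowObj

  record ArrowHom (a b : ArrowObj) : Set ℓ where
    constructor square
    field
      top     : X [ src a , src b ]
      bottom  : X [ tgt a , tgt b ]
      commute : arr b X.∘ top ≡ bottom X.∘ arr a

  open ArrowHom

  arrow-hom-≡ : ∀ {a b} {m n : ArrowHom a b} → top m ≡ top n → bottom m ≡ bottom n → m ≡ n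
  arrow-hom-≡ {m = square f g e} {square .f .g e′} refl refl = cong (square f g) (uip e e′)

  Arrow : Category ℓ
  Arrow = record
    { Obj = ArrowObj
    ; Hom = ArrowHom
    ; id = square X.id X.id (trans (X.identityʳ _) (sym (X.identityˡ _)))
    ; _∘_ = λ { (square g g′ e) (square f f′ d) → square (g X.∘ f) (g′ X.∘ f′)
        (trans (sym (X.assoc _ _ _))
        (trans (cong (X._∘ f) e)
        (trans (X.assoc _ _ _)
        (trans (cong (g′ X.∘_) d) (sym (X.assoc _ _ _)))))) }
    ; identityˡ = λ _ → arrow-hom-≡ (X.identityˡ _) (X.identityˡ _)
    ; identityʳ = λ _ → arrow-hom-≡ (X.identityʳ _) (X.identityʳ _)
    ; assoc = λ _ _ _ → arrow-hom-≡ (X.assoc _ _ _) (X.assoc _ _ _)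
    }

  dom : Functor Arrow X
  dom = record
    { F₀ = src ; F₁ = top ; identity = refl ; homomorphism = λ _ _ → refl }

  cod : Functor Arrow X
  cod = record
    { F₀ = tgt ; F₁ = bottom ; identity = refl ; homomorphism = λ _ _ → refl }

  tautological : dom ⇒ cod
  tautological = record { η = arr ; natural = commute }

  identities : Functor X Arrow
  identities = record
    { F₀ = λ _ → arrow X.id
    ; F₁ = λ f → square f f (trans (X.identityˡ f) (sym (X.identityʳ f)))
    ; identity = arrow-hom-≡ refl refl
    ; homomorphism = λ _ _ → arrow-hom-≡ refl refl
    }

infix 12 _²

_² : Functor X Y → Functor (Arrow X) (Arrow Y)
_² {Y = Y} F = record
  { F₀ = λ { (arrow h) → arrow (F₁ F h) }
  ; F₁ = λ { (square f g e) → square (F₁ F f) (F₁ F g)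
      (trans (sym (Functor.homomorphism F _ _))
      (trans (cong (F₁ F) e) (Functor.homomorphism F _ _))) }
  ; identity = arrow-hom-≡ Y (Functor.identity F) (Functor.identity F)
  ; homomorphism = λ _ _ →
      arrow-hom-≡ Y (Functor.homomorphism F _ _) (Functor.homomorphism F _ _)
  }

module _ {E B : Category ℓ} (p : Functor E B) where

  private
    module E = Category E
    module B = Category B

  IsCartesian : ∀ {a b} → E [ a , b ] → Set (lsuc ℓ)
  IsCartesian {a} {b} f =
    ∀ {c} (g : E [ c , b ]) (w : B [ F₀ p c , F₀ p a ]) → F₁ p f B.∘ w ≡ F₁ p g →
    ∃! _≡_ λ (v : E [ c , a ]) → F₁ p v ≡ w × f E.∘ v ≡ g

  IsOpcartesian : ∀ {a b} → E [ a , b ] → Set (lsuc ℓ)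
  IsOpcartesian {a} {b} f =
    ∀ {c} (g : E [ a , c ]) (w : B [ F₀ p b , F₀ p c ]) → w B.∘ F₁ p f ≡ F₁ p g →
    ∃! _≡_ λ (v : E [ b , c ]) → F₁ p v ≡ w × v E.∘ f ≡ g

  record CartesianLift {x} (b : Obj E) (u : B [ x , F₀ p b ]) : Set (lsuc ℓ) where
    field
      {obj}     : Obj E
      arr       : E [ obj , b ]
      obj-over  : F₀ p obj ≡ x
      arr-over  : F₁ p arr ≅ u
      cartesian : IsCartesian arr

  record OpcartesianLift {x} (a : Obj E) (u : B [ F₀ p a , x ]) : Set (lsuc ℓ) where
    field
      {obj}       : Obj E
      arr         : E [ a , obj ]
      obj-over    : F₀ p obj ≡ x
      arr-over    : F₁ p arr ≅ u
      opcartesian : IsOpcartesian arr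

  IsFibration : Set (lsuc ℓ)
  IsFibration = ∀ {x} b (u : B [ x , F₀ p b ]) → CartesianLift b u

  IsOpfibration : Set (lsuc ℓ)
  IsOpfibration = ∀ {x} a (u : B [ F₀ p a , x ]) → OpcartesianLift a u

  IsFaithful : Set (lsuc ℓ)
  IsFaithful = ∀ {a b} {f g : E [ a , b ]} → F₁ p f ≡ F₁ p g → f ≡ g

  IsVertical : ∀ {a b} → E [ a , b ] → Set (lsuc ℓ)
  IsVertical {a} {b} f = F₀ p a ≡ F₀ p b × F₁ p f ≅ B.id {F₀ p a}

PreservesCartesian : Functor C B → Functor D B → Functor C D → Set (lsuc _)
PreservesCartesian {C = C} q p F =
  ∀ {a b} {f : C [ a , b ]} → IsCartesian q f → IsCartesian p (F₁ F f)

-- Sets of functors and of transformations are predicates invariant under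
-- equality.  "Rule idF" says that a category belongs to the theory.  A policy
-- between rules fills a triangle, any side of which may be an identity.
record JudgementalTheory (ctx : Category ℓ) : Set (lsuc (lsuc (lsuc ℓ))) where
  field
    terminal : Terminal ctx

    Rule   : {C D : Category ℓ} → Functor C D → Set (lsuc (lsuc ℓ))
    Policy : {C D : Category ℓ} {F G : Functor C D} → F ⇒ G → Set (lsuc (lsuc ℓ))

    rule-resp   : {F G : Functor C D} → F ≡F G → Rule F → Rule G
    policy-resp : {F F′ G G′ : Functor C D} {α : F ⇒ G} {α′ : F′ ⇒ G′} →
                  α ≡N α′ → Policy α → Policy α′

    ctx-idF       : Rule (idF {C = ctx})
    domain-idF    : {F : Functor C D} → Rule F → Rule (idF {C = C})
    codomain-idF  : {F : Functor C D} → Rule F → Rule (idF {C = D})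
    policy-source : {F G : Functor C D} {α : F ⇒ G} → Policy α → Rule F
    policy-target : {F G : Functor C D} {α : F ⇒ G} → Policy α → Rule G

    rule-∘    : {G : Functor B C} {F : Functor A B} → Rule G → Rule F → Rule (G ∘F F)
    policy-id : {F : Functor C D} → Rule F → Policy (idN {F = F})
    policy-∘  : {F G H : Functor C D} {β : G ⇒ H} {α : F ⇒ G} →
                Policy β → Policy α → Policy (β ∘ᵥ α)
    whiskerˡ  : {H : Functor C D} {F G : Functor B C} {α : F ⇒ G} →
                Rule H → Policy α → Policy (H ∘ˡ α)
    whiskerʳ  : {F G : Functor B C} {α : F ⇒ G} {K : Functor A B} →
                Policy α → Rule K → Policy (α ∘ʳ K)

    -- A functor (or transformation) into a limit is the one
    -- induced by its composites with the projections, so closure under the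
    -- universal property says that it belongs to the theory when they do.
    pullback-π₁     : {F : Functor A C} {G : Functor B C} →
                      Rule F → Rule G → Rule (π₁ F G)
    pullback-π₂     : {F : Functor A C} {G : Functor B C} →
                      Rule F → Rule G → Rule (π₂ F G)
    pullback-rule   : {F : Functor A C} {G : Functor B C} → Rule F → Rule G →
                      (H : Functor X (Pullback F G)) →
                      Rule (π₁ F G ∘F H) → Rule (π₂ F G ∘F H) → Rule H
    pullback-policy : {F : Functor A C} {G : Functor B C} → Rule F → Rule G →
                      {H K : Functor X (Pullback F G)} → Rule H → Rule K → (α : H ⇒ K) →
                      Policy (π₁ F G ∘ˡ α) → Policy (π₂ F G ∘ˡ α) → Policy α

    equalizer-equalize : {F G : Functor A B} → Rule F → Rule G → Rule (equalize F G)
    equalizer-rule     : {F G : Functor A B} → Rule F → Rule G →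
                         (H : Functor X (Equalizer F G)) →
                         Rule (equalize F G ∘F H) → Rule H
    equalizer-policy   : {F G : Functor A B} → Rule F → Rule G →
                         {H K : Functor X (Equalizer F G)} → Rule H → Rule K → (α : H ⇒ K) →
                         Policy (equalize F G ∘ˡ α) → Policy α

    power-idF    : Rule (idF {C = X}) → ∀ n → Rule (idF {C = Power X n})
    power-proj   : Rule (idF {C = X}) → ∀ n i → Rule (proj X n i)
    power-rule   : Rule (idF {C = X}) → ∀ n → Rule (idF {C = C}) →
                   (H : Functor C (Power X n)) →
                   (∀ i → Rule (proj X n i ∘F H)) → Rule H
    power-policy : Rule (idF {C = X}) → ∀ n →
                   {H K : Functor C (Power X n)} → Rule H → Rule K → (α : H ⇒ K) →
                   (∀ i → Policy (proj X n i ∘ˡ α)) → Policy α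

    arrow-dom          : Rule (idF {C = X}) → Rule (dom X)
    arrow-cod          : Rule (idF {C = X}) → Rule (cod X)
    arrow-tautological : Rule (idF {C = X}) → Policy (tautological X)
    arrow-rule         : Rule (idF {C = X}) → (H : Functor C (Arrow X)) →
                         Policy (tautological X ∘ʳ H) → Rule H
    arrow-policy       : Rule (idF {C = X}) →
                         {H K : Functor C (Arrow X)} → Rule H → Rule K → (α : H ⇒ K) →
                         Policy (dom X ∘ˡ α) → Policy (cod X ∘ˡ α) → Policy α

    -- The functor L sends (a , b) to (Λ a , b[λ♯ a]), and κ consists of the
    -- cartesian lifts b[λ♯ a] ⟶ b of the components of λ♯; this determines L
    -- and κ once lifts are chosen, and every choice of lifts is admitted.
    ♯-lifting : {Λ : Functor A B} {r : Functor A X} {r′ : Functor B X} {h : Functor C X} →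
                Rule Λ → Rule r → Rule r′ → Rule h → IsFibration h →
                {λ♯ : r′ ∘F Λ ⇒ r} → Policy λ♯ →
                (L : Functor (Pullback r h) (Pullback r′ h)) →
                π₁ r′ h ∘F L ≡F Λ ∘F π₁ r h →
                (κ : π₂ r′ h ∘F L ⇒ π₂ r h) →
                (∀ x → F₁ h (η κ x) ≅ η λ♯ (F₀ (π₁ r h) x) × IsCartesian h (η κ x)) →
                Rule L × Policy κ
    ♯-oplifting : {Λ : Functor A B} {r : Functor A X} {r′ : Functor B X} {h : Functor C X} →
                  Rule Λ → Rule r → Rule r′ → Rule h → IsOpfibration h →
                  {λ♯ : r ⇒ r′ ∘F Λ} → Policy λ♯ →
                  (L : Functor (Pullback r h) (Pullback r′ h)) →
                  π₁ r′ h ∘F L ≡F Λ ∘F π₁ r h →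
                  (κ : π₂ r h ⇒ π₂ r′ h ∘F L) →
                  (∀ x → F₁ h (η κ x) ≅ η λ♯ (F₀ (π₁ r h) x) × IsOpcartesian h (η κ x)) →
                  Rule L × Policy κ

  Judgement : Functor C ctx → Set (lsuc (lsuc ℓ))
  Judgement = Rule

record FiniteSet ℓ : Set (lsuc ℓ) where
  field
    Carrier : Set ℓ
    size    : ℕ
    enum    : Carrier ↔ Fin size

  open Inverse enum public using (to; from; strictlyInverseˡ; strictlyInverseʳ)

open FiniteSet using (Carrier; size)

-- A function between finite sets is given by its table of values, so that
-- equal functions are propositionally equal.
Table : FiniteSet ℓ → FiniteSet ℓ → Set ℓ
Table S T = Vec (Carrier T) (size S)

apply : (S T : FiniteSet ℓ) → Table S T → Carrier S → Carrier T
apply S T t s = lookup t (FiniteSet.to S s)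

FinSets : ∀ ℓ → Category ℓ
FinSets ℓ = record
  { Obj = FiniteSet ℓ
  ; Hom = Table
  ; id = λ {S} → tabulate (FiniteSet.from S)
  ; _∘_ = λ {_} {S} {T} g f → map (apply S T g) f
  ; identityˡ = λ {_} {S} f →
      trans (map-cong (λ s → trans (lookup∘tabulate (FiniteSet.from S) (FiniteSet.to S s)) (FiniteSet.strictlyInverseʳ S s)) f)
            (map-id f)
  ; identityʳ = λ {S} {T} f →
      trans (sym (tabulate-∘ (apply S T f) (FiniteSet.from S)))
      (trans (tabulate-cong (λ i → cong (lookup f) (FiniteSet.strictlyInverseˡ S i)))
             (tabulate∘lookup f))
  ; assoc = λ {_} {S} {T} {U} h g f →
      trans (map-cong (λ s → lookup-map (FiniteSet.to S s) (apply T U h) g) f)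
            (map-∘ (apply T U h) (apply S T g) f)
  }

record FiberedTerminal {E B : Category ℓ} (p : Functor E B) : Set (lsuc ℓ) where
  field
    truth     : Functor B E
    over      : p ∘F truth ≡F idF
    cartesian : PreservesCartesian idF p truth
    universal : ∀ {θ x} → F₀ p θ ≡ x →
                ∃! _≡_ λ (h : E [ θ , F₀ truth x ]) → IsVertical p h

record FiberedInitial {E B : Category ℓ} (p : Functor E B) : Set (lsuc ℓ) where
  field
    falsity   : Functor B E
    over      : p ∘F falsity ≡F idF
    cartesian : PreservesCartesian idF p falsity
    universal : ∀ {θ x} → F₀ p θ ≡ x →
                ∃! _≡_ λ (h : E [ F₀ falsity x , θ ]) → IsVertical p h

record FiberedProducts {E B : Category ℓ} (p : Functor E B) : Set (lsuc ℓ) where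
  field
    conjunction  : Functor (Pullback p p) E
    over         : p ∘F conjunction ≡F p ∘F π₁ p p
    cartesian    : PreservesCartesian (p ∘F π₁ p p) p conjunction
    fst          : conjunction ⇒ π₁ p p
    snd          : conjunction ⇒ π₂ p p
    fst-vertical : ∀ a → IsVertical p (η fst a)
    snd-vertical : ∀ a → IsVertical p (η snd a)
    universal    : ∀ {θ} a {f : E [ θ , F₀ (π₁ p p) a ]} {g : E [ θ , F₀ (π₂ p p) a ]} →
                   IsVertical p f → IsVertical p g →
                   ∃! _≡_ λ (h : E [ θ , F₀ conjunction a ]) →
                     IsVertical p h × E [ η fst a ∘ h ] ≡ f × E [ η snd a ∘ h ] ≡ g

  infixr 7 _∧_[_]

  _∧_[_] : ∀ φ ψ → F₀ p φ ≡ F₀ p ψ → Obj E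
  φ ∧ ψ [ e ] = F₀ conjunction ⟪ φ , ψ , e ⟫

-- The fiberwise opposite of a faithful fibration.  An arrow φ ⟶ ψ over u is a
-- vertical arrow u*ψ ⟶ φ, unique if it exists since the fibers are preorders.
module _ {E B : Category ℓ} (p : Functor E B)
         (faithful : IsFaithful p) (fibration : IsFibration p) where

  private
    module E = Category E
    module B = Category B

    open CartesianLift

    retype : ∀ {a a′ b b′} → a ≡ a′ → b ≡ b′ → (u : B [ a , b ]) →
             Σ[ u′ ∈ B [ a′ , b′ ] ] u′ ≅ u
    retype refl refl u = u , refl

    factor : ∀ {b c x y} {u : B [ x , F₀ p b ]} (L : CartesianLift p b u)
             (g : E [ c , b ]) (w : B [ y , x ]) → F₀ p c ≡ y → F₁ p g ≅ u B.∘ w →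
             Σ[ k ∈ E [ c , obj L ] ] F₁ p k ≅ w
    factor L g w e d with retype (sym e) (sym (obj-over L)) w
    ... | w′ , w′≅w with cartesian L g w′ (≅-to-≡ (≅-trans
            (B.∘-resp-≅ e (obj-over L) refl (arr-over L) w′≅w) (≅-sym d)))
    ...   | k , (pk≡w′ , _) , _ = k , ≅-trans (≡-to-≅ pk≡w′) w′≅w

  record OpHom (φ ψ : Obj E) : Set ℓ where
    constructor opposite
    field
      base     : B [ F₀ p φ , F₀ p ψ ]
      fiber    : E [ obj (fibration ψ base) , φ ]
      vertical : F₁ p fiber ≅ B.id {F₀ p φ}

  open OpHom

  private
    hom-≡ : ∀ {φ ψ} {m n : OpHom φ ψ} → base m ≡ base n → m ≡ n
    hom-≡ {m = opposite u v e} {opposite .u v′ e′} refl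
      with faithful {f = v} {g = v′} (≅-to-≡ (≅-trans e (≅-sym e′)))
    ... | refl = cong (opposite u v) (≅-irrelevant e e′)

    op-id : ∀ {φ} → OpHom φ φ
    op-id {φ} = opposite B.id (arr L) (arr-over L)
      where L = fibration φ B.id

    op-∘ : ∀ {φ ψ ρ} → OpHom ψ ρ → OpHom φ ψ → OpHom φ ρ
    op-∘ {φ} {ψ} {ρ} (opposite w z z-vert) (opposite u v v-vert) =
      opposite (w B.∘ u) (v E.∘ m)
        (≅-trans (≡-to-≅ (Functor.homomorphism p v m))
        (≅-trans (B.∘-resp-≅ (obj-over N) (obj-over M) refl v-vert m-vert)
        (≡-to-≅ (B.identityˡ B.id))))
      where
      L = fibration ρ w
      M = fibration ψ u
      N = fibration ρ (w B.∘ u)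

      k : E [ obj N , obj L ]
      k = Σ.proj₁ (factor L (arr N) u (obj-over N) (arr-over N))

      k-over : F₁ p k ≅ u
      k-over = Σ.proj₂ (factor L (arr N) u (obj-over N) (arr-over N))

      zk-over : F₁ p (z E.∘ k) ≅ u B.∘ B.id
      zk-over = ≅-trans (≡-to-≅ (Functor.homomorphism p z k))
        (≅-trans (B.∘-resp-≅ (obj-over N) (obj-over L) refl z-vert k-over)
        (≡-to-≅ (trans (B.identityˡ u) (sym (B.identityʳ u)))))

      m : E [ obj N , obj M ]
      m = Σ.proj₁ (factor M (z E.∘ k) B.id (obj-over N) zk-over)

      m-vert : F₁ p m ≅ B.id {F₀ p φ}
      m-vert = Σ.proj₂ (factor M (z E.∘ k) B.id (obj-over N) zk-over)

  Opposite : Category ℓ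
  Opposite = record
    { Obj = Obj E
    ; Hom = OpHom
    ; id = op-id
    ; _∘_ = op-∘
    ; identityˡ = λ _ → hom-≡ (B.identityˡ _)
    ; identityʳ = λ _ → hom-≡ (B.identityʳ _)
    ; assoc = λ _ _ _ → hom-≡ (B.assoc _ _ _)
    }

  opposite-fibration : Functor Opposite B
  opposite-fibration = record
    { F₀ = F₀ p ; F₁ = base ; identity = refl ; homomorphism = λ _ _ → refl }

-- The transpose of g : θ ∧ φ ⟶ ψ is an arrow h : θ ⟶ (φ ⇨ ψ) such that
-- eval ∘ (h ∧ id) ≡ g; the pair (h , id) is an arrow of Pullback p p.
record FiberedImplication {E B : Category ℓ} (p : Functor E B)
         (faithful : IsFaithful p) (fibration : IsFibration p)
         (products : FiberedProducts p) : Set (lsuc ℓ) where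

  private
    pᵒᵖ = opposite-fibration p faithful fibration

  open FiberedProducts products using (conjunction; _∧_[_])

  field
    implication : Functor (Pullback pᵒᵖ p) E
    over        : p ∘F implication ≡F pᵒᵖ ∘F π₁ pᵒᵖ p
    cartesian   : PreservesCartesian (pᵒᵖ ∘F π₁ pᵒᵖ p) p implication

  _⇨_[_] : ∀ φ ψ → F₀ p φ ≡ F₀ p ψ → Obj E
  φ ⇨ ψ [ e ] = F₀ implication ⟪ φ , ψ , e ⟫

  field
    eval          : ∀ {φ ψ} (e : F₀ p φ ≡ F₀ p ψ) →
                    E [ (φ ⇨ ψ [ e ]) ∧ φ [ eq₀ over ⟪ φ , ψ , e ⟫ ] , ψ ]
    eval-vertical : ∀ {φ ψ} (e : F₀ p φ ≡ F₀ p ψ) → IsVertical p (eval e)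
    universal     : ∀ {θ φ ψ} (e : F₀ p φ ≡ F₀ p ψ) (d : F₀ p θ ≡ F₀ p φ)
                    {g : E [ θ ∧ φ [ d ] , ψ ]} → IsVertical p g →
                    ∃! _≡_ λ (m : Pullback p p [ ⟪ θ , φ , d ⟫
                                               , ⟪ φ ⇨ ψ [ e ] , φ , eq₀ over ⟪ φ , ψ , e ⟫ ⟫ ]) →
                      F₁ (π₂ p p) m ≡ Category.id E × E [ eval e ∘ F₁ conjunction m ] ≡ g

record NaturalDeductionClassifier {ctx ℙ : Category ℓ} (p : Functor ℙ ctx) : Set (lsuc ℓ) where
  field
    faithful    : IsFaithful p
    fibration   : IsFibration p
    products    : FiberedProducts p
    terminal    : FiberedTerminal p
    implication : FiberedImplication p faithful fibration products
    initial     : FiberedInitial p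

  open FiberedProducts products public using (conjunction; _∧_[_])
  open FiberedTerminal terminal public using (truth)
  open FiberedImplication implication public using (_⇨_[_]) renaming (implication to implies)
  open FiberedInitial initial public using (falsity)

-- The rules a natural deduction theory is generated from; there are no
-- generating policies.  Being substitutional is a condition on these rules: p is
-- a fibration and the operators preserve cartesian arrows.  It is not imposed on
-- all rules and policies derived from them, where it fails: every arrow of ℙ is
-- a component of the policy "tautological ℙ", and over finite sets the judgement
-- dom ctx ∘F equalize (dom ctx) (cod ctx) is not a fibration.
data Generator {ctx ℙ : Category ℓ} {p : Functor ℙ ctx} (N : NaturalDeductionClassifier p) :
               {C D : Category ℓ} → Functor C D → Set (lsuc (lsuc ℓ)) where
  gen-p : Generator N p
  gen-∧ : Generator N (NaturalDeductionClassifier.conjunction N)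
  gen-⊤ : Generator N (NaturalDeductionClassifier.truth N)
  gen-⇨ : Generator N (NaturalDeductionClassifier.implies N)
  gen-⊥ : Generator N (NaturalDeductionClassifier.falsity N)

record IsGeneratedBy {ctx : Category ℓ}
                     (G : {C D : Category ℓ} → Functor C D → Set (lsuc (lsuc ℓ)))
                     (T : JudgementalTheory ctx) : Set (lsuc (lsuc (lsuc ℓ))) where
  open JudgementalTheory

  Contains : JudgementalTheory ctx → Set (lsuc (lsuc ℓ))
  Contains T′ = ∀ {C D : Category ℓ} {F : Functor C D} → G F → Rule T′ F

  field
    contains     : Contains T
    least-rule   : ∀ T′ → Contains T′ → {F : Functor C D} → Rule T F → Rule T′ F
    least-policy : ∀ T′ → Contains T′ → {F H : Functor C D} {α : F ⇒ H} →
                   Policy T α → Policy T′ α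

record NaturalDeductionTheory ℓ : Set (lsuc (lsuc (lsuc ℓ))) where

  ctx : Category ℓ
  ctx = FinSets ℓ

  field
    ℙ         : Category ℓ
    p         : Functor ℙ ctx
    structure : NaturalDeductionClassifier p
    theory    : JudgementalTheory ctx
    generated : IsGeneratedBy (Generator structure) theory

  open NaturalDeductionClassifier structure public
  open JudgementalTheory theory public using (Rule; Policy; Judgement)

  -- An object of 𝔼 over x is a vertical arrow ψ ⟶ φ over x, that is, x; ψ ⊢ φ.

  𝔼 : Category ℓ
  𝔼 = Pullback (p ²) (identities ctx)

  e : Functor 𝔼 ctx
  e = π₂ (p ²) (identities ctx)

  antecedent succedent : Functor 𝔼 ℙ
  antecedent = dom ℙ ∘F π₁ (p ²) (identities ctx)
  succedent  = cod ℙ ∘F π₁ (p ²) (identities ctx)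

  antecedent-over : ∀ j → F₀ p (F₀ antecedent j) ≡ F₀ e j
  antecedent-over ⟪ _ , _ , q ⟫ = cong (F₀ (dom ctx)) q

  succedent-over : ∀ j → F₀ p (F₀ succedent j) ≡ F₀ e j
  succedent-over ⟪ _ , _ , q ⟫ = cong (F₀ (cod ctx)) q

{-# OPTIONS --safe #-}

-- The structure map ψ ⟶ φ of an object of 𝔼 is a component of the tautological
-- policy.  Paired with the identity of χ it is a policy between functors into
-- Pullback p p, and whiskering it with conjunction gives a policy with
-- components ψ ∧ χ ⟶ φ ∧ χ.  The universal properties of the arrow category and
-- of the pullback turn this policy into a rule with values in 𝔼.
module Submission where

open import Defs
open import Data.Product using (Σ-syntax; _×_; _,_)
open import Relation.Binary.HeterogeneousEquality using (_≅_; refl; ≡-to-≅)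
  renaming (trans to ≅-trans)
open import Relation.Binary.PropositionalEquality using (_≡_; refl; sym; trans)

open Functor using (F₀; F₁)
open _≡F_ using (eq₀; eq₁)
open _⇒_ using (η)
open ArrowObj using (arr)
open ArrowHom using (top; bottom)

module _ {ℓ} {A B C X : Category ℓ} {F : Functor A C} {G : Functor B C} where

  pair : (H : Functor X A) (K : Functor X B) → F ∘F H ≡F G ∘F K → Functor X (Pullback F G)
  pair H K over = record
    { F₀ = λ x → ⟪ F₀ H x , F₀ K x , eq₀ over x ⟫
    ; F₁ = λ f → ⟪ F₁ H f , F₁ K f , eq₁ over f ⟫
    ; identity = pullback-hom-≡ F G (Functor.identity H) (Functor.identity K)
    ; homomorphism = λ g f →
        pullback-hom-≡ F G (Functor.homomorphism H g f) (Functor.homomorphism K g f)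
    }

  -- Arrows of `Pullback F G` are equal once both components agree, so naturality is inherited
  -- factor by factor; the components need only have the same image in the base.
  pairN : {H H′ : Functor X A} {K K′ : Functor X B}
          (over : F ∘F H ≡F G ∘F K) (over′ : F ∘F H′ ≡F G ∘F K′)
          (α : H ⇒ H′) (β : K ⇒ K′) →
          (∀ x → F₁ F (η α x) ≅ F₁ G (η β x)) →
          pair H K over ⇒ pair H′ K′ over′
  pairN over over′ α β αβ-over = record
    { η = λ x → ⟪ η α x , η β x , αβ-over x ⟫
    ; natural = λ f → pullback-hom-≡ F G (_⇒_.natural α f) (_⇒_.natural β f)
    }

module _ {ℓ} {C X : Category ℓ} where

  -- Existence in the universal property of the arrow category: whiskering `tautological X` with
  -- this functor gives `α` back.
  transpose : {F G : Functor C X} → F ⇒ G → Functor C (Arrow X)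
  transpose {F} {G} α = record
    { F₀ = λ a → arrow (η α a)
    ; F₁ = λ f → square (F₁ F f) (F₁ G f) (_⇒_.natural α f)
    ; identity = arrow-hom-≡ X (Functor.identity F) (Functor.identity G)
    ; homomorphism = λ g f →
        arrow-hom-≡ X (Functor.homomorphism F g f) (Functor.homomorphism G g f)
    }

  module _ {H K : Functor C (Arrow X)} where

    private
      arrow-≡ : ∀ {a a′ b b′} → a ≡ a′ → b ≡ b′ →
                {f : X [ a , b ]} {f′ : X [ a′ , b′ ]} → f ≅ f′ →
                arrow {X = X} f ≡ arrow f′
      arrow-≡ refl refl refl = refl

      arrow-hom-≅ : ∀ {a a′ b b′ : ArrowObj X} → a ≡ a′ → b ≡ b′ →
                    {m : ArrowHom X a b} {m′ : ArrowHom X a′ b′} →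
                    top m ≅ top m′ → bottom m ≅ bottom m′ → m ≅ m′
      arrow-hom-≅ refl refl refl refl = ≡-to-≅ (arrow-hom-≡ X refl refl)

    -- Uniqueness in the same universal property: `dom` and `cod` detect the action on arrows, and
    -- the components of the whiskered transformation are the objects themselves.
    ≡F-from-tautological : (tautological X ∘ʳ H) ≡N (tautological X ∘ʳ K) → H ≡F K
    ≡F-from-tautological same = record
      { eq₀ = objects
      ; eq₁ = λ f → arrow-hom-≅ (objects _) (objects _) (eq₁ source f) (eq₁ target f)
      }
      where
      open _≡N_ same
      objects : ∀ a → F₀ H a ≡ F₀ K a
      objects a = arrow-≡ (eq₀ source a) (eq₀ target a) (eqη a)

module _ {ℓ} {X : Category ℓ} where

  arr-≅ : {a b : ArrowObj X} → a ≡ b → arr a ≅ arr b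
  arr-≅ refl = refl

  -- The endpoint equations are hypotheses because equality of two hom types does not yield equality
  -- of their endpoints.
  top-≅ : {a a′ b b′ : ArrowObj X} → a ≡ a′ → b ≡ b′ →
          {m : ArrowHom X a b} {m′ : ArrowHom X a′ b′} → m ≅ m′ → top m ≅ top m′
  top-≅ refl refl refl = refl

  bottom-≅ : {a a′ b b′ : ArrowObj X} → a ≡ a′ → b ≡ b′ →
             {m : ArrowHom X a b} {m′ : ArrowHom X a′ b′} → m ≅ m′ → bottom m ≅ bottom m′
  bottom-≅ refl refl refl = refl

module _ {ℓ} {ctx : Category ℓ} (T : JudgementalTheory ctx) where

  open JudgementalTheory T

  private
    variable
      A B C D X : Category ℓ

  rule-pair : {F : Functor A C} {G : Functor B C} → Rule F → Rule G →
              {H : Functor X A} {K : Functor X B} → Rule H → Rule K →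
              (over : F ∘F H ≡F G ∘F K) → Rule (pair {F = F} {G} H K over)
  rule-pair F-rule G-rule H-rule K-rule over = pullback-rule F-rule G-rule (pair _ _ over)
    -- Each projection of the pair has the data of `H` or `K`, possibly with other proofs of the
    -- functor laws, which `rule-resp` disregards.
    (rule-resp (record { eq₀ = λ _ → refl ; eq₁ = λ _ → refl }) H-rule)
    (rule-resp (record { eq₀ = λ _ → refl ; eq₁ = λ _ → refl }) K-rule)

  policy-pairN : {F : Functor A C} {G : Functor B C} → Rule F → Rule G →
                 {H H′ : Functor X A} {K K′ : Functor X B}
                 (over : F ∘F H ≡F G ∘F K) (over′ : F ∘F H′ ≡F G ∘F K′) →
                 {α : H ⇒ H′} {β : K ⇒ K′} → Policy α → Policy β →
                 (αβ-over : ∀ x → F₁ F (η α x) ≅ F₁ G (η β x)) →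
                 Policy (pairN {F = F} {G} over over′ α β αβ-over)
  policy-pairN F-rule G-rule over over′ {α} {β} α-policy β-policy αβ-over =
    pullback-policy F-rule G-rule
      (rule-pair F-rule G-rule (policy-source α-policy) (policy-source β-policy) over)
      (rule-pair F-rule G-rule (policy-target α-policy) (policy-target β-policy) over′)
      (pairN over over′ α β αβ-over)
      (policy-resp (record
        { source = record { eq₀ = λ _ → refl ; eq₁ = λ _ → refl }
        ; target = record { eq₀ = λ _ → refl ; eq₁ = λ _ → refl }
        ; eqη = λ _ → refl }) α-policy)
      (policy-resp (record
        { source = record { eq₀ = λ _ → refl ; eq₁ = λ _ → refl }
        ; target = record { eq₀ = λ _ → refl ; eq₁ = λ _ → refl }
        ; eqη = λ _ → refl }) β-policy)

  rule-transpose : {F G : Functor C X} {α : F ⇒ G} → Policy α → Rule (transpose α)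
  rule-transpose {α = α} α-policy =
    arrow-rule (codomain-idF (policy-source α-policy)) (transpose α)
    (policy-resp (record
      { source = record { eq₀ = λ _ → refl ; eq₁ = λ _ → refl }
      ; target = record { eq₀ = λ _ → refl ; eq₁ = λ _ → refl }
      ; eqη = λ _ → refl }) α-policy)

  -- `F ²` is the transpose of `F ∘ˡ tautological C`, a policy by closure under whiskering.
  rule-² : {F : Functor C D} → Rule F → Rule (F ²)
  rule-² F-rule = rule-resp
    (record { eq₀ = λ _ → refl ; eq₁ = λ _ → ≡-to-≅ (arrow-hom-≡ _ refl refl) })
    (rule-transpose (whiskerˡ F-rule (arrow-tautological (domain-idF F-rule))))

  -- Here the transposed policy is the identity transformation of `idF`.
  rule-identities : Rule (idF {C = X}) → Rule (identities X)
  rule-identities X-rule = rule-resp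
    (record { eq₀ = λ _ → refl ; eq₁ = λ _ → ≡-to-≅ (arrow-hom-≡ _ refl refl) })
    (rule-transpose (policy-id X-rule))

module _ {ℓ} (N : NaturalDeductionTheory ℓ) where

  open NaturalDeductionTheory N
  open JudgementalTheory theory
    using (ctx-idF; domain-idF; rule-∘; policy-id; whiskerˡ; whiskerʳ;
           pullback-π₁; pullback-π₂; arrow-tautological)
  open IsGeneratedBy generated using (contains)

  private
    module ctx = Category ctx

    judgement : Functor (Pullback e p) 𝔼
    judgement = π₁ e p

    formula : Functor (Pullback e p) ℙ
    formula = π₂ e p

    entailment : antecedent ⇒ succedent
    entailment = record
      { η = λ j → arr (PullbackObj.fst j)
      ; natural = λ f → ArrowHom.commute (PullbackHom.fst f) }

    -- The equation carried by an object of `𝔼` identifies whole arrows of the base; this extracts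
    -- the arrow, while `antecedent-over` and `succedent-over` extract the endpoints.
    entailment-vertical : ∀ j → F₁ p (η entailment j) ≅ ctx.id {F₀ e j}
    entailment-vertical j = arr-≅ (PullbackObj.over j)

    antecedent-over-e : p ∘F antecedent ≡F e
    antecedent-over-e = record
      { eq₀ = antecedent-over
      ; eq₁ = λ {i} {j} f →
          top-≅ (PullbackObj.over i) (PullbackObj.over j) (PullbackHom.over f) }

    succedent-over-e : p ∘F succedent ≡F e
    succedent-over-e = record
      { eq₀ = succedent-over
      ; eq₁ = λ {i} {j} f →
          bottom-≅ (PullbackObj.over i) (PullbackObj.over j) (PullbackHom.over f) }

    -- `F` is instantiated with `antecedent` and with `succedent`, giving the two boundaries of the
    -- policy to be conjoined.
    module _ {F : Functor 𝔼 ℙ} (F-over : p ∘F F ≡F e) where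

      over-formula : p ∘F (F ∘F judgement) ≡F p ∘F formula
      over-formula = record
        { eq₀ = λ { ⟪ j , _ , x ⟫ → trans (eq₀ F-over j) x }
        ; eq₁ = λ f → ≅-trans (eq₁ F-over (PullbackHom.fst f)) (PullbackHom.over f) }

      with-formula : Functor (Pullback e p) (Pullback p p)
      with-formula = pair (F ∘F judgement) formula over-formula

      conjoined-over-e : p ∘F (conjunction ∘F with-formula) ≡F e ∘F judgement
      conjoined-over-e = record
        { eq₀ = λ a → trans (eq₀ ∧-over (F₀ with-formula a)) (eq₀ F-over (PullbackObj.fst a))
        ; eq₁ = λ f → ≅-trans (eq₁ ∧-over (F₁ with-formula f))
                              (eq₁ F-over (PullbackHom.fst f)) }
        where open FiberedProducts products using () renaming (over to ∧-over)

    paired-entailment : with-formula antecedent-over-e ⇒ with-formula succedent-over-e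
    paired-entailment = pairN (over-formula antecedent-over-e) (over-formula succedent-over-e)
      (entailment ∘ʳ judgement) idN
      -- The entailment lies over the identity of `F₀ e j`, the second component over the identity
      -- of the context of the formula; `x` equates these contexts.
      λ { ⟪ j , _ , x ⟫ → ≅-trans (entailment-vertical j)
            (≅-trans (ctx.id-≅ x) (≡-to-≅ (sym (Functor.identity p)))) }

    conjoined : conjunction ∘F with-formula antecedent-over-e ⇒
                conjunction ∘F with-formula succedent-over-e
    conjoined = conjunction ∘ˡ paired-entailment

    conjoined-vertical : p ² ∘F transpose conjoined ≡F identities ctx ∘F (e ∘F judgement)
    conjoined-vertical = ≡F-from-tautological record
      { source = record
          { eq₀ = eq₀ (conjoined-over-e antecedent-over-e)
          ; eq₁ = eq₁ (conjoined-over-e antecedent-over-e) }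
      ; target = record
          { eq₀ = eq₀ (conjoined-over-e succedent-over-e)
          ; eq₁ = eq₁ (conjoined-over-e succedent-over-e) }
      -- Conjunction lies over its first factor, so the image of the conjoined arrow under `p` is
      -- that of the entailment, an identity.
      ; eqη = λ a → ≅-trans (eq₁ (FiberedProducts.over products) (η paired-entailment a))
                            (entailment-vertical (PullbackObj.fst a)) }

    p-rule : Rule p
    p-rule = contains gen-p

    p²-rule : Rule (p ²)
    p²-rule = rule-² theory p-rule

    identities-rule : Rule (identities ctx)
    identities-rule = rule-identities theory ctx-idF

    e-rule : Rule e
    e-rule = pullback-π₂ p²-rule identities-rule

    judgement-rule : Rule judgement
    judgement-rule = pullback-π₁ e-rule p-rule

    entailment-policy : Policy (entailment ∘ʳ judgement)
    entailment-policy = whiskerʳ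
      (JudgementalTheory.policy-resp theory (record
        { source = record { eq₀ = λ _ → refl ; eq₁ = λ _ → refl }
        ; target = record { eq₀ = λ _ → refl ; eq₁ = λ _ → refl }
        ; eqη = λ _ → refl })
        (whiskerʳ (arrow-tautological (domain-idF p-rule)) (pullback-π₁ p²-rule identities-rule)))
      judgement-rule

    paired-entailment-policy : Policy paired-entailment
    paired-entailment-policy = policy-pairN theory p-rule p-rule
      (over-formula antecedent-over-e) (over-formula succedent-over-e)
      entailment-policy (policy-id (pullback-π₂ e-rule p-rule)) _

  conjoin : Functor (Pullback e p) 𝔼
  -- With `e ∘F judgement` as second component the result lies over the original context by
  -- definition.
  conjoin = pair (transpose conjoined) (e ∘F judgement) conjoined-vertical

  conjoin-rule : Rule conjoin
  conjoin-rule = rule-pair theory p²-rule identities-rule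
    (rule-transpose theory (whiskerˡ (contains gen-∧) paired-entailment-policy))
    (rule-∘ e-rule judgement-rule)
    conjoined-vertical

lemma4p2p3 : ∀ {ℓ} (N : NaturalDeductionTheory ℓ) →
    let open NaturalDeductionTheory N in
    Σ[ f ∈ Functor (Pullback e p) 𝔼 ]
    Rule f ×
    (∀ j χ (x : F₀ e j ≡ F₀ p χ) →
    F₀ e (F₀ f ⟪ j , χ , x ⟫) ≡ F₀ e j ×
    F₀ antecedent (F₀ f ⟪ j , χ , x ⟫) ≡ F₀ antecedent j ∧ χ [ trans (antecedent-over j) x ] ×
    F₀ succedent (F₀ f ⟪ j , χ , x ⟫) ≡ F₀ succedent j ∧ χ [ trans (succedent-over j) x ])
-- In the last two equations the proof built by `over-formula` computes to the very `trans` term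
-- that indexes the conjunction, so `refl` suffices.
lemma4p2p3 N = conjoin N , conjoin-rule N , λ _ _ _ → refl , refl , refl
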